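{- Let $R$ be a nonvoid connected tight relation on $X\times Y$ that preserves both attribute and association privacy. Then $|X|=|Y|\geq 3$ and $R$ is isomorphic to either a cyclic staircase relation or a spherical boundary relation.
   Context: Everything is finite. A relation $R$ on $X\times Y$ is a subset of $X\times Y$; it is void if $X=\emptyset$ or $Y=\emptyset$. For $x\in X$, $Y_x=\{y\in Y:(x,y)\in R\}$ (a row); for $y\in Y$, $X_y=\{x\in X:(x,y)\in R\}$ (a column); a row or column is blank if it is empty. $R$ is tight if it has no blank rows or columns. $R$ is connected if it is connected as an undirected bipartite graph on the disjoint union of $X$ and $Y$ with edge set $R$. For $\sigma\subseteq X$, $\phi_R(\sigma)=\bigcap_{x\in\sigma}Y_x$ with $\phi_R(\emptyset)=Y$; for $\gamma\subseteq Y$, $\psi_R(\gamma)=\bigcap_{y\in\gamma}X_y$ with $\psi_R(\emptyset)=X$. For nonvoid $R$, $\Phi_R=\{\gamma\subseteq Y:\exists x\in X\ \forall y\in\gamma\ (x,y)\in R\}$ and $\Psi_R=\{\sigma\subseteq X:\exists y\in Y\ \forall x\in\sigma\ (x,y)\in R\}$ (both contain $\emptyset$). $R$ preserves attribute privacy if $(\phi_R\circ\psi_R)(\gamma)=\gamma$ for all $\gamma\in\Phi_R$ (including $\gamma=\emptyset$); $R$ preserves association privacy if $(\psi_R\circ\phi_R)(\sigma)=\sigma$ for all $\sigma\in\Psi_R$ (including $\sigma=\emptyset$). Two relations are isomorphic if there are bijections between their sets of individuals and between their sets of attributes carrying one relation onto the other. For $n\ge3$, a cyclic staircase relation is the relation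 on $\{x_1,\dots,x_n\}\times\{y_1,\dots,y_n\}$ given by $\{(x_i,y_i):1\le i\le n\}\cup\{(x_i,y_{i+1}):1\le i<n\}\cup\{(x_n,y_1)\}$ (up to isomorphism). For $n\ge 3$, a spherical boundary relation is the relation on $\{x_1,\dots,x_n\}\times\{y_1,\dots,y_n\}$ given by $\{(x_i,y_j): i\neq j\}$ (up to isomorphism). -}

module Defs where

open import Level using (Level; 0ℓ; _⊔_)
open import Data.Nat using (ℕ; suc; _≤_)
open import Data.Fin using (Fin; toℕ)
open import Data.Fin.Subset using (Subset; _∈_; ⋂; Empty)
open import Data.Fin.Subset.Properties using (_∈?_)
open import Data.List using (map; filter; allFin)
open import Data.Vec using (tabulate)
open import Data.Product using (Σ-syntax; ∃-syntax; _×_)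
open import Data.Sum using (_⊎_; inj₁; inj₂)
open import Function.Bundles using (_⤖_; _⇔_; module Bijection)
open import Relation.Nullary using (¬_; does)
open import Relation.Unary using (Pred)
open import Relation.Binary using (Rel; REL; Decidable)
open import Relation.Binary.Construct.Closure.Equivalence using (EqClosure)
open import Relation.Binary.PropositionalEquality using (_≡_; _≢_)

private
  variable
    a b : Level
    m n m′ n′ : ℕ

-- The finite sets X and Y are Fin m and Fin n.  A subset of X × Y is a
-- decidable R : REL (Fin m) (Fin n) a; decidability is what lets rows and
-- columns be elements of Subset, whose equality is propositional.

Void : REL (Fin m) (Fin n) a → Set
Void {m} {n} _ = m ≡ 0 ⊎ n ≡ 0

module _ {R : REL (Fin m) (Fin n) a} (R? : Decidable R) where

  row : Fin m → Subset n
  row x = tabulate (λ y → does (R? x y))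

  column : Fin n → Subset m
  column y = tabulate (λ x → does (R? x y))

  Tight : Set
  Tight = (∀ x → ¬ Empty (row x)) × (∀ y → ¬ Empty (column y))

  -- The intersection ⋂ of the empty list is the full subset.

  φ : Subset m → Subset n
  φ σ = ⋂ (map row (filter (_∈? σ) (allFin m)))

  ψ : Subset n → Subset m
  ψ γ = ⋂ (map column (filter (_∈? γ) (allFin n)))

module _ (R : REL (Fin m) (Fin n) a) where

  Φ : Pred (Subset n) a
  Φ γ = ∃[ x ] (∀ y → y ∈ γ → R x y)

  Ψ : Pred (Subset m) a
  Ψ σ = ∃[ y ] (∀ x → x ∈ σ → R x y)

  data Edge : Rel (Fin m ⊎ Fin n) a where
    edge : ∀ {x y} → R x y → Edge (inj₁ x) (inj₂ y)

  -- EqClosure Edge u v is the type of undirected walks from u to v.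

  Connected : Set a
  Connected = ∀ u v → EqClosure Edge u v

module _ {R : REL (Fin m) (Fin n) a} (R? : Decidable R) where

  PreservesAttributePrivacy : Set a
  PreservesAttributePrivacy = ∀ γ → Φ R γ → φ R? (ψ R? γ) ≡ γ

  PreservesAssociationPrivacy : Set a
  PreservesAssociationPrivacy = ∀ σ → Ψ R σ → ψ R? (φ R? σ) ≡ σ

infix 4 _≅_

_≅_ : REL (Fin m) (Fin n) a → REL (Fin m′) (Fin n′) b → Set (a ⊔ b)
_≅_ {m} {n} {_} {m′} {n′} R S =
  Σ[ f ∈ Fin m ⤖ Fin m′ ] Σ[ g ∈ Fin n ⤖ Fin n′ ]
    (∀ x y → R x y ⇔ S (Bijection.to f x) (Bijection.to g y))

data CyclicStaircase (k : ℕ) : Rel (Fin k) 0ℓ where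
  diagonal : ∀ {i} → CyclicStaircase k i i
  step     : ∀ {i j} → toℕ j ≡ suc (toℕ i) → CyclicStaircase k i j
  wrap     : ∀ {i j} → suc (toℕ i) ≡ k → toℕ j ≡ 0 → CyclicStaircase k i j

SphericalBoundary : (k : ℕ) → Rel (Fin k) 0ℓ
SphericalBoundary k i j = i ≢ j

IsCyclicStaircase : REL (Fin m) (Fin n) a → Set a
IsCyclicStaircase R = ∃[ k ] (3 ≤ k × R ≅ CyclicStaircase k)

IsSphericalBoundary : REL (Fin m) (Fin n) a → Set a
IsSphericalBoundary R = ∃[ k ] (3 ≤ k × R ≅ SphericalBoundary k)

{-# OPTIONS --safe #-}
module Submission where

open import Defs
open import Level using (Level; 0ℓ)
open import Data.Bool using (Bool; true)
open import Data.Fin using (Fin; zero; suc; toℕ; fromℕ<)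
open import Data.Fin.Permutation using (↔⇒≡)
open import Data.Fin.Properties
  using (_≟_; any?; toℕ<n; toℕ-injective; toℕ-fromℕ<; injective⇒≤; pigeonhole)
open import Data.Fin.Subset
  using (Subset; Empty; inside; outside; _∈_; _∉_; _─_; _-_; ∣_∣; ⋂)
open import Data.Fin.Subset.Properties
  using (_∈?_; nonempty?; ∈⊤; x∈⁅x⁆; x∈p∩q⁺; x∈p∩q⁻; p─q⊆p; x∈p∧x≢y⇒x∈p-y; x∈p⇒∣p-x∣<∣p∣)
open import Data.List using (List; []; _∷_; map; filter; allFin)
open import Data.List.Membership.Propositional.Properties using (∈-allFin; ∈-filter⁺; ∈-filter⁻)
open import Data.List.Relation.Unary.All as All using (All; []; _∷_)
import Data.List.Relation.Unary.All.Properties as All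
open import Data.Nat using (ℕ; zero; suc; _+_; _≤_; _<_; _≥_; z≤n; z<s; s≤s; s≤s⁻¹)
open import Data.Nat.Induction using (<-rec)
import Data.Nat.Properties as ℕ
open import Data.Product as Product using (∃-syntax; _×_; _,_; proj₁; proj₂)
open import Data.Sum as Sum using (_⊎_; inj₁; inj₂; [_,_]′)
open import Data.Sum.Properties using (swap-involutive)
open import Data.Vec using ([]; _∷_; here; there; tabulate)
open import Data.Vec.Properties using (lookup∘tabulate; lookup⇒[]=; []=⇒lookup)
open import Function using (_∘_; flip; id)
open import Function.Bundles using (_⤖_; _⇔_; mk⇔; mk⤖; module Bijection)
open import Function.Construct.Identity using (⤖-id)
open import Function.Construct.Symmetry using (⤖-sym; ⇔-sym)
open import Function.Properties.Bijection using (⤖⇒↔)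
open import Relation.Binary using (REL; Decidable; tri<; tri≈; tri>)
open import Relation.Binary.Construct.Closure.Equivalence using (EqClosure)
open import Relation.Binary.Construct.Closure.ReflexiveTransitive as Star using (ε; _◅_)
import Relation.Binary.Construct.Closure.Symmetric as Sym
open import Relation.Binary.PropositionalEquality
  using (_≡_; _≢_; refl; sym; trans; cong; subst; subst₂; ≢-sym)
open import Relation.Nullary using (¬_; does; yes; no; contradiction)
open import Relation.Nullary.Decidable using (dec-true; _×-dec_; ¬?; decidable-stable)
open import Relation.Unary using (Pred)
import Relation.Unary as U

-- Write N(v) for the neighbours of v.  Privacy says that for every edge x-y
-- some x′ misses y but has all other neighbours of x, and dually.  Fixing y,
-- the maps y′ ↦ x′ inject the other neighbours of x into the other neighbours
-- of y; with the dual injection they are bijections.  So if x and x′ are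
-- distinct and share a neighbour, N(x) and N(x′) differ by one element each way.
--
-- If x has three neighbours, the elements by which the various N(x′) exceed
-- N(x) coincide, and by connectedness it is the only non-neighbour of x.  Having
-- three neighbours passes to adjacent vertices, so R is a spherical boundary.
-- Otherwise every vertex has exactly two neighbours and R is a cycle.

private
  variable
    a p : Level
    m n k : ℕ

-- Membership in differences, tabulated subsets and intersections.

x∈p─q⇒x∉q : ∀ {x} (p q : Subset n) → x ∈ p ─ q → x ∉ q
x∈p─q⇒x∉q (_ ∷ p) (inside  ∷ q) (there x∈p─q) (there x∈q) = x∈p─q⇒x∉q p q x∈p─q x∈q
x∈p─q⇒x∉q (_ ∷ p) (outside ∷ q) (there x∈p─q) (there x∈q) = x∈p─q⇒x∉q p q x∈p─q x∈q

x∈p-y⁻ : ∀ {x} (p : Subset n) y → x ∈ p - y → x ∈ p × x ≢ y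
x∈p-y⁻ p y x∈p-y =
  p─q⊆p p _ x∈p-y , λ { refl → x∈p─q⇒x∉q p _ x∈p-y (x∈⁅x⁆ _) }

module _ {f : Fin n → Bool} {i : Fin n} where

  ∈-tabulate⁺ : f i ≡ true → i ∈ tabulate f
  ∈-tabulate⁺ eq = lookup⇒[]= i _ (trans (lookup∘tabulate f i) eq)

  ∈-tabulate⁻ : i ∈ tabulate f → f i ≡ true
  ∈-tabulate⁻ i∈ = trans (sym (lookup∘tabulate f i)) ([]=⇒lookup i∈)

∈-⋂⁺ : ∀ {i : Fin n} {ps} → All (i ∈_) ps → i ∈ ⋂ ps
∈-⋂⁺ []       = ∈⊤
∈-⋂⁺ (i∈ ∷ is) = x∈p∩q⁺ (i∈ , ∈-⋂⁺ is)

∈-⋂⁻ : ∀ {i : Fin n} ps → i ∈ ⋂ ps → All (i ∈_) ps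
∈-⋂⁻ []       _  = []
∈-⋂⁻ (p ∷ ps) i∈ with i∈p , i∈ps ← x∈p∩q⁻ p (⋂ ps) i∈ = i∈p ∷ ∈-⋂⁻ ps i∈ps

module _ (f : Fin m → Subset n) (σ : Subset m) {i : Fin n} where

  private
    members : List (Fin m)
    members = filter (_∈? σ) (allFin m)

  ∈-⋂-filter⁺ : (∀ j → j ∈ σ → i ∈ f j) → i ∈ ⋂ (map f members)
  ∈-⋂-filter⁺ h = ∈-⋂⁺ (All.map⁺ (All.tabulate λ j∈ → h _ (proj₂ (∈-filter⁻ (_∈? σ) {xs = allFin m} j∈))))

  ∈-⋂-filter⁻ : i ∈ ⋂ (map f members) → ∀ j → j ∈ σ → i ∈ f j
  ∈-⋂-filter⁻ i∈ j j∈σ =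
    All.lookup (All.map⁻ (∈-⋂⁻ (map f members) i∈)) (∈-filter⁺ (_∈? σ) (∈-allFin j) j∈σ)

-- Injections between finite subsets.

module _ (F : REL (Fin m) (Fin n) a) where

  -- `F` is a relation and not a function: a vertex may have several replacements, and no choice
  -- among them has to be fixed.
  InjectiveOn : Subset m → Set a
  InjectiveOn p = ∀ {i i′ j} → i ∈ p → i′ ∈ p → F i j → F i′ j → i ≡ i′

  MapsInto : Subset m → Subset n → Set a
  MapsInto p q = ∀ {i} → i ∈ p → ∃[ j ] j ∈ q × F i j

-- By injectivity no later element is related to the value `j₀` of the first one, so `j₀` can be
-- struck from the target.
MapsInto-∷⁻ : ∀ {F : REL (Fin (suc m)) (Fin n) a} {p : Subset m} {q : Subset n} {j₀} →
              InjectiveOn F (inside ∷ p) → MapsInto F (inside ∷ p) q → F zero j₀ →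
              MapsInto (F ∘ suc) p (q - j₀)
MapsInto-∷⁻ inj into Fj₀ i∈p with j , j∈q , Fj ← into (there i∈p) =
  j , x∈p∧x≢y⇒x∈p-y j∈q (λ { refl → contradiction (inj here (there i∈p) Fj₀ Fj) λ () }) , Fj

InjectiveOn-∷⁻ : ∀ {F : REL (Fin (suc m)) (Fin n) a} {s} {p : Subset m} →
                 InjectiveOn F (s ∷ p) → InjectiveOn (F ∘ suc) p
InjectiveOn-∷⁻ inj i∈ i′∈ Fi Fi′ with refl ← inj (there i∈) (there i′∈) Fi Fi′ = refl

injectiveOn⇒∣p∣≤∣q∣ : ∀ {F : REL (Fin m) (Fin n) a} (p : Subset m) (q : Subset n) →
                      InjectiveOn F p → MapsInto F p q → ∣ p ∣ ≤ ∣ q ∣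
injectiveOn⇒∣p∣≤∣q∣ []            q inj into = z≤n
injectiveOn⇒∣p∣≤∣q∣ {F = F} (outside ∷ p) q inj into =
  injectiveOn⇒∣p∣≤∣q∣ p q (InjectiveOn-∷⁻ {F = F} inj) (into ∘ there)
injectiveOn⇒∣p∣≤∣q∣ {F = F} (inside ∷ p)  q inj into with j₀ , j₀∈q , Fj₀ ← into here =
  ℕ.≤-trans
    (s≤s (injectiveOn⇒∣p∣≤∣q∣ p (q - j₀) (InjectiveOn-∷⁻ {F = F} inj) (MapsInto-∷⁻ {F = F} inj into Fj₀)))
    (x∈p⇒∣p-x∣<∣p∣ j₀∈q)

-- Striking out a matched pair preserves the size inequality. An element of `q` is either the struck
-- `j₀` or is reached by induction.
injectiveOn⇒surjectiveOn : ∀ {F : REL (Fin m) (Fin n) a} (p : Subset m) (q : Subset n) →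
                           InjectiveOn F p → MapsInto F p q → ∣ q ∣ ≤ ∣ p ∣ →
                           MapsInto (flip F) q p
injectiveOn⇒surjectiveOn [] q inj into ∣q∣≤∣p∣ j∈q =
  contradiction (ℕ.≤-trans (x∈p⇒∣p-x∣<∣p∣ j∈q) ∣q∣≤∣p∣) λ ()
injectiveOn⇒surjectiveOn {F = F} (outside ∷ p) q inj into ∣q∣≤∣p∣ j∈q
  with i , i∈p , Fi ← injectiveOn⇒surjectiveOn p q (InjectiveOn-∷⁻ {F = F} inj) (into ∘ there) ∣q∣≤∣p∣ j∈q
  = suc i , there i∈p , Fi
injectiveOn⇒surjectiveOn {F = F} (inside ∷ p) q inj into ∣q∣≤∣p∣ {j} j∈q
  with j₀ , j₀∈q , Fj₀ ← into here | j ≟ j₀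
... | yes refl = zero , here , Fj₀
... | no j≢j₀
  with i , i∈p , Fi ← injectiveOn⇒surjectiveOn p (q - j₀)
         (InjectiveOn-∷⁻ {F = F} inj) (MapsInto-∷⁻ {F = F} inj into Fj₀)
         (s≤s⁻¹ (ℕ.≤-trans (x∈p⇒∣p-x∣<∣p∣ j₀∈q) ∣q∣≤∣p∣))
         (x∈p∧x≢y⇒x∈p-y j∈q j≢j₀)
  = suc i , there i∈p , Fi

-- From privacy to replacement.

module _ {R : REL (Fin m) (Fin n) a} (R? : Decidable R) where

  ∈-row⁺ : ∀ {x y} → R x y → y ∈ row R? x
  ∈-row⁺ {x} {y} r = ∈-tabulate⁺ (dec-true (R? x y) r)

  ∈-row⁻ : ∀ {x y} → y ∈ row R? x → R x y
  ∈-row⁻ {x} {y} y∈ with R? x y | ∈-tabulate⁻ {f = λ y → does (R? x y)} y∈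
  ... | yes r | _ = r
  ... | no _  | ()

-- Privacy is used only in this form: an edge x-y lets some x′ take over
-- every neighbour of x except y.

Replaces : REL (Fin m) (Fin n) a → Fin m → Fin n → Fin m → Set a
Replaces R x y x′ = ¬ R x′ y × (∀ {w} → R x w → w ≢ y → R x′ w)

module _ {R : REL (Fin m) (Fin n) a} (R? : Decidable R) where

  -- Let `γ` be the row of `x` without `y`; it lies in `Φ R`. If every row containing `γ` also
  -- contained `y`, then `y` would lie in the closure of `γ`, which is `γ` itself.
  attributePrivacy⇒replaces : PreservesAttributePrivacy R? →
                              ∀ {x y} → R x y → ∃[ x′ ] Replaces R x y x′
  attributePrivacy⇒replaces priv {x} {y} Rxy
    with any? (λ x′ → (x′ ∈? ψ R? (row R? x - y)) ×-dec ¬? (R? x′ y))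
  ... | yes (x′ , x′∈ψγ , ¬Rx′y) = x′ , ¬Rx′y , λ {w} Rxw w≢y →
    ∈-row⁻ (flip R?) (∈-⋂-filter⁻ (column R?) _ x′∈ψγ w (x∈p∧x≢y⇒x∈p-y (∈-row⁺ R? Rxw) w≢y))
  ... | no ∄x′ = contradiction refl (proj₂ (x∈p-y⁻ (row R? x) y y∈γ))
    where
    γ = row R? x - y
    y∈γ : y ∈ γ
    y∈γ = subst (y ∈_) (priv γ (x , λ w → ∈-row⁻ R? ∘ proj₁ ∘ x∈p-y⁻ (row R? x) y))
      (∈-⋂-filter⁺ (row R?) _ λ x′ x′∈ψγ → ∈-row⁺ R?
        (decidable-stable (R? x′ y) λ ¬Rx′y → ∄x′ (x′ , x′∈ψγ , ¬Rx′y)))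

  nonempty-rows : (∀ x → ¬ Empty (row R? x)) → ∀ x → ∃[ y ] R x y
  nonempty-rows tight x =
    Product.map₂ (∈-row⁻ R?) (decidable-stable (nonempty? (row R? x)) (tight x))

-- Duality and propagation along walks.

connected-flip : ∀ {R : REL (Fin m) (Fin n) a} → Connected R → Connected (flip R)
connected-flip {R = R} conn u v =
  subst₂ (EqClosure (Edge (flip R))) (swap-involutive u) (swap-involutive v)
    (Star.gmap Sum.swap flipEdge (conn (Sum.swap u) (Sum.swap v)))
  where
  flipEdge : ∀ {u v} → Sym.SymClosure (Edge R) u v →
             Sym.SymClosure (Edge (flip R)) (Sum.swap u) (Sum.swap v)
  flipEdge (Sym.fwd (edge r)) = Sym.bwd (edge r)
  flipEdge (Sym.bwd (edge r)) = Sym.fwd (edge r)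

-- The hypotheses in a form closed under exchanging individuals and attributes, so that each result
-- dualizes through `flipped`.
record ConnectedPrivate {m n} (R : REL (Fin m) (Fin n) a) : Set a where
  field
    R?             : Decidable R
    connected      : Connected R
    neighbour      : ∀ x → ∃[ y ] R x y
    neighbourᶜ     : ∀ y → ∃[ x ] R x y
    replacement    : ∀ {x y} → R x y → ∃[ x′ ] Replaces R x y x′
    replacementᶜ   : ∀ {x y} → R x y → ∃[ y′ ] Replaces (flip R) y x y′

  -- Connectedness as induction along a walk; every later use of it has this form.
  spread : ∀ {P : Pred (Fin m) p} {Q : Pred (Fin n) p} →
           (∀ {x y} → R x y → P x → Q y) → (∀ {x y} → R x y → Q y → P x) →
           ∀ {x₀} → P x₀ → (∀ x → P x) × (∀ y → Q y)
  spread {P = P} {Q} P⇒Q Q⇒P {x₀} Px₀ =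
    (λ x → along (connected (inj₁ x₀) (inj₁ x)) Px₀) , (λ y → along (connected (inj₁ x₀) (inj₂ y)) Px₀)
    where
    along : ∀ {u v} → EqClosure (Edge R) u v → [ P , Q ]′ u → [ P , Q ]′ v
    along ε                         h = h
    along (Sym.fwd (edge r) ◅ walk) h = along walk (P⇒Q r h)
    along (Sym.bwd (edge r) ◅ walk) h = along walk (Q⇒P r h)

flipped : ∀ {R : REL (Fin m) (Fin n) a} → ConnectedPrivate R → ConnectedPrivate (flip R)
flipped P = record
  { R?           = flip R?
  ; connected    = connected-flip connected
  ; neighbour    = neighbourᶜ
  ; neighbourᶜ   = neighbour
  ; replacement  = replacementᶜ
  ; replacementᶜ = replacement
  }
  where open ConnectedPrivate P

-- Comparing the neighbourhoods of two individuals.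

module Neighbourhoods {R : REL (Fin m) (Fin n) a} (P : ConnectedPrivate R) where
  open ConnectedPrivate P

  private
    others : Fin m → Fin n → Subset n
    others x y = row R? x - y

    othersᶜ : Fin n → Fin m → Subset m
    othersᶜ y x = row (flip R?) y - x

  -- An individual that replaces `y₂` keeps every other neighbour of `x`, so it cannot miss a
  -- different `y₁`.
  replaces-injectiveOn : ∀ x y → InjectiveOn (Replaces R x) (others x y)
  replaces-injectiveOn x y {y₁} {y₂} y₁∈ y₂∈ (¬Rx′y₁ , _) (_ , keeps) with y₁ ≟ y₂
  ... | yes y₁≡y₂ = y₁≡y₂
  ... | no  y₁≢y₂ = contradiction (keeps (∈-row⁻ R? (proj₁ (x∈p-y⁻ (row R? x) y y₁∈))) y₁≢y₂) ¬Rx′y₁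

  replaces-mapsInto : ∀ {x y} → R x y → MapsInto (Replaces R x) (others x y) (othersᶜ y x)
  replaces-mapsInto {x} {y} Rxy {y′} y′∈ with Rxy′ , y′≢y ← x∈p-y⁻ (row R? x) y y′∈
    with x′ , ¬Rx′y′ , keeps ← replacement (∈-row⁻ R? Rxy′)
    = x′
    , x∈p∧x≢y⇒x∈p-y (∈-row⁺ (flip R?) (keeps Rxy (≢-sym y′≢y))) (λ { refl → ¬Rx′y′ (∈-row⁻ R? Rxy′) })
    , ¬Rx′y′ , keeps

  ∣others∣≤∣othersᶜ∣ : ∀ {x y} → R x y → ∣ others x y ∣ ≤ ∣ othersᶜ y x ∣
  ∣others∣≤∣othersᶜ∣ {x} {y} Rxy =
    injectiveOn⇒∣p∣≤∣q∣ _ _ (replaces-injectiveOn x y) (replaces-mapsInto Rxy)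

module Exchange {R : REL (Fin m) (Fin n) a} (P : ConnectedPrivate R) where
  open ConnectedPrivate P
  open Neighbourhoods P

  abstract
    -- The dual injection bounds the sizes the other way, so the injection of `replaces-mapsInto` is
    -- onto: `x′` itself arises as a replacement.
    exchange : ∀ {x x′ y} → R x y → R x′ y → x′ ≢ x →
               ∃[ y′ ] R x y′ × y′ ≢ y × Replaces R x y′ x′
    exchange {x} {x′} {y} Rxy Rx′y x′≢x
      with y′ , y′∈ , rep ← injectiveOn⇒surjectiveOn _ _
             (replaces-injectiveOn x y) (replaces-mapsInto Rxy)
             (Neighbourhoods.∣others∣≤∣othersᶜ∣ (flipped P) Rxy)
             (x∈p∧x≢y⇒x∈p-y (∈-row⁺ (flip R?) Rx′y) x′≢x)
      with Rxy′ , y′≢y ← x∈p-y⁻ (row R? x) y y′∈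
      = y′ , ∈-row⁻ R? Rxy′ , y′≢y , rep

  -- Exchange with `x` and `x′` swapped: `x` has every neighbour of `x′` but one, and both `u` and
  -- `v` must be that one.
  extra-unique : ∀ {x x′ y u v} → R x y → R x′ y →
                 R x′ u → ¬ R x u → R x′ v → ¬ R x v → u ≡ v
  extra-unique {x} {x′} {u = u} {v} Rxy Rx′y Rx′u ¬Rxu Rx′v ¬Rxv
    with y′ , _ , _ , _ , keeps ← exchange Rx′y Rxy (λ { refl → ¬Rxu Rx′u })
    = trans (only Rx′u ¬Rxu) (sym (only Rx′v ¬Rxv))
    where
    only : ∀ {w} → R x′ w → ¬ R x w → w ≡ y′
    only {w} Rx′w ¬Rxw = decidable-stable (w ≟ y′) (λ w≢y′ → ¬Rxw (keeps Rx′w w≢y′))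

  abstract
    -- If `y` were the only neighbour of `x`, exchange would make `x` the only neighbour of `y`.
    -- This edge would then be the whole graph, leaving no replacement for `x`.
    another : ∀ {x y} → R x y → ∃[ y′ ] R x y′ × y′ ≢ y
    another {x} {y} Rxy with any? (λ y′ → R? x y′ ×-dec ¬? (y′ ≟ y))
    ... | yes found = found
    ... | no ∄y′ with x′ , ¬Rx′y , _ ← replacement Rxy =
      contradiction (subst (λ w → R w y) (sym (proj₁ (spread fw bw refl) x′)) Rxy) ¬Rx′y
      where
      fw : ∀ {w z} → R w z → w ≡ x → z ≡ y
      fw {z = z} Rwz refl = decidable-stable (z ≟ y) (λ z≢y → ∄y′ (z , Rwz , z≢y))
      bw : ∀ {w z} → R w z → z ≡ y → w ≡ x
      bw {w} Rwz refl = decidable-stable (w ≟ x) λ w≢x →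
        let y′ , Rxy′ , y′≢y , _ = exchange Rxy Rwz w≢x in ∄y′ (y′ , Rxy′ , y′≢y)

  m≥3 : Fin m → 3 ≤ m
  m≥3 x with y , Rxy ← neighbour x
        with y′ , Rxy′ , y′≢y ← another Rxy
        -- The three individuals are `x` and its replacements for two neighbours; `x₂` keeps `y`,
        -- which `x₁` misses.
        with x₁ , ¬Rx₁y  , keeps₁ ← replacement Rxy
           | x₂ , ¬Rx₂y′ , keeps₂ ← replacement Rxy′
    = injective⇒≤ {f = f} (λ {i} {j} → f-injective i j)
    where
    f : Fin 3 → Fin m
    f zero             = x
    f (suc zero)       = x₁
    f (suc (suc zero)) = x₂
    x≢x₁ : x ≢ x₁
    x≢x₁ refl = ¬Rx₁y Rxy
    x≢x₂ : x ≢ x₂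
    x≢x₂ refl = ¬Rx₂y′ Rxy′
    x₁≢x₂ : x₁ ≢ x₂
    x₁≢x₂ refl = ¬Rx₁y (keeps₂ Rxy (≢-sym y′≢y))
    f-injective : ∀ i j → f i ≡ f j → i ≡ j
    f-injective zero             zero             _  = refl
    f-injective zero             (suc zero)       eq = contradiction eq x≢x₁
    f-injective zero             (suc (suc zero)) eq = contradiction eq x≢x₂
    f-injective (suc zero)       zero             eq = contradiction (sym eq) x≢x₁
    f-injective (suc zero)       (suc zero)       _  = refl
    f-injective (suc zero)       (suc (suc zero)) eq = contradiction eq x₁≢x₂
    f-injective (suc (suc zero)) zero             eq = contradiction (sym eq) x≢x₂
    f-injective (suc (suc zero)) (suc zero)       eq = contradiction (sym eq) x₁≢x₂
    f-injective (suc (suc zero)) (suc (suc zero)) _  = refl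

-- Three neighbours: the spherical boundary.

ThreeNeighbours : REL (Fin m) (Fin n) a → Fin m → Set a
ThreeNeighbours R x = ∃[ y₁ ] ∃[ y₂ ] ∃[ y₃ ]
  (R x y₁ × R x y₂ × R x y₃) × (y₁ ≢ y₂ × y₁ ≢ y₃ × y₂ ≢ y₃)

avoiding : ∀ {R : REL (Fin m) (Fin n) a} {x} → ThreeNeighbours R x →
           ∀ u v → ∃[ y ] R x y × y ≢ u × y ≢ v
avoiding (y₁ , y₂ , y₃ , (r₁ , r₂ , r₃) , (y₁≢y₂ , y₁≢y₃ , y₂≢y₃)) u v
  with y₁ ≟ u | y₁ ≟ v
... | no y₁≢u  | no y₁≢v  = y₁ , r₁ , y₁≢u , y₁≢v
... | yes refl | _ with y₂ ≟ v
...   | no y₂≢v  = y₂ , r₂ , ≢-sym y₁≢y₂ , y₂≢v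
...   | yes refl = y₃ , r₃ , ≢-sym y₁≢y₃ , ≢-sym y₂≢y₃
avoiding (y₁ , y₂ , y₃ , (r₁ , r₂ , r₃) , (y₁≢y₂ , y₁≢y₃ , y₂≢y₃)) u v
    | no _ | yes refl with y₂ ≟ u
...   | no y₂≢u  = y₂ , r₂ , y₂≢u , ≢-sym y₁≢y₂
...   | yes refl = y₃ , r₃ , ≢-sym y₂≢y₃ , ≢-sym y₁≢y₃

module Wide {R : REL (Fin m) (Fin n) a} (P : ConnectedPrivate R) where
  open ConnectedPrivate P
  open Exchange P
  open Exchange (flipped P) using () renaming (extra-unique to extra-uniqueᶜ)

  threeNeighbours? : U.Decidable (ThreeNeighbours R)
  threeNeighbours? x = any? λ y₁ → any? λ y₂ → any? λ y₃ →
    (R? x y₁ ×-dec R? x y₂ ×-dec R? x y₃) ×-dec (¬? (y₁ ≟ y₂) ×-dec ¬? (y₁ ≟ y₃) ×-dec ¬? (y₂ ≟ y₃))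

  -- The replacements of `x` for two neighbours other than `y` both keep `y`; together with `x` they
  -- are the three neighbours of `y`.
  threeNeighbours-adjacent : ∀ {x y} → R x y → ThreeNeighbours R x → ThreeNeighbours (flip R) y
  threeNeighbours-adjacent {x} {y} Rxy three
    with y₁ , Rxy₁ , y₁≢y , _ ← avoiding {R = R} three y y
    with y₂ , Rxy₂ , y₂≢y , y₂≢y₁ ← avoiding {R = R} three y y₁
    with x₁ , ¬Rx₁y₁ , keeps₁ ← replacement Rxy₁
       | x₂ , ¬Rx₂y₂ , keeps₂ ← replacement Rxy₂
    = x , x₁ , x₂ , (Rxy , keeps₁ Rxy (≢-sym y₁≢y) , keeps₂ Rxy (≢-sym y₂≢y))
    , (λ { refl → ¬Rx₁y₁ Rxy₁ }) , (λ { refl → ¬Rx₂y₂ Rxy₂ })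
    , (λ { refl → ¬Rx₁y₁ (keeps₂ Rxy₁ (≢-sym y₂≢y₁)) })

  -- A column that drops x from y contains both x′ and x″ but not x.
  common-extra : ∀ {x x′ x″ y u v} → R x y → R x′ y → R x″ y →
                 R x′ u → ¬ R x u → R x″ v → ¬ R x v → u ≡ v
  common-extra Rxy Rx′y Rx″y Rx′u ¬Rxu Rx″v ¬Rxv
    with y* , ¬Rxy* , keeps ← replacementᶜ Rxy
    = trans (extra-unique Rxy Rx′y Rx′u ¬Rxu (keeps Rx′y (λ { refl → ¬Rxu Rx′u })) ¬Rxy*)
      (sym (extra-unique Rxy Rx″y Rx″v ¬Rxv (keeps Rx″y (λ { refl → ¬Rxv Rx″v })) ¬Rxy*))

  -- Each of `x′` and `x″` misses a single neighbour of `x`. A third neighbour is common to all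
  -- three, which reduces the claim to `common-extra`.
  extra-agree : ∀ {x x′ x″ y′ y″ u v} → ThreeNeighbours R x →
                R x y′ → R x′ y′ → R x y″ → R x″ y″ →
                R x′ u → ¬ R x u → R x″ v → ¬ R x v → u ≡ v
  extra-agree three Rxy′ Rx′y′ Rxy″ Rx″y″ Rx′u ¬Rxu Rx″v ¬Rxv
    with w′ , _ , _ , _ , keeps′ ← exchange Rxy′ Rx′y′ (λ { refl → ¬Rxu Rx′u })
       | w″ , _ , _ , _ , keeps″ ← exchange Rxy″ Rx″y″ (λ { refl → ¬Rxv Rx″v })
    with y , Rxy , y≢w′ , y≢w″ ← avoiding {R = R} three w′ w″
    = common-extra Rxy (keeps′ Rxy y≢w′) (keeps″ Rxy y≢w″) Rx′u ¬Rxu Rx″v ¬Rxv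

  -- All vertices at distance 2 from x have the same neighbour z outside the
  -- neighbourhood of x, and z has no neighbours elsewhere.
  abstract
    unique-nonneighbour : ∀ {x} → ThreeNeighbours R x →
                          ∃[ z ] ¬ R x z × (∀ y → R x y ⊎ y ≡ z)
    unique-nonneighbour {x} three@(y₁ , y₂ , _ , (Rxy₁ , Rxy₂ , _) , (y₁≢y₂ , _))
      with x₁ , ¬Rx₁y₁ , keeps₁ ← replacement Rxy₁
         | x₂ , ¬Rx₂y₂ , keeps₂ ← replacement Rxy₂
      with Rx₁y₂ ← keeps₁ Rxy₂ (≢-sym y₁≢y₂) | Rx₂y₁ ← keeps₂ Rxy₁ y₁≢y₂
      -- Exchange from `x₁` to `x` yields the neighbour `z` of `x₁` that `x` misses; `z₂` comes from
      -- `x₂` likewise.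
      with z  , Rx₁z  , z≢y₂ , ¬Rxz  , _ ← exchange Rx₁y₂ Rxy₂ (λ { refl → ¬Rx₁y₁ Rxy₁ })
         | z₂ , Rx₂z₂ , _    , ¬Rxz₂ , _ ← exchange Rx₂y₁ Rxy₁ (λ { refl → ¬Rx₂y₂ Rxy₂ })
      with refl ← extra-agree three Rxy₂ Rx₁y₂ Rxy₁ Rx₂y₁ Rx₁z ¬Rxz Rx₂z₂ ¬Rxz₂
      = z , ¬Rxz , proj₂ (spread fw bw (inj₁ refl))
      where
      Near : Pred (Fin m) a
      Near x′ = x′ ≡ x ⊎ ∃[ y ] R x y × R x′ y

      near-z : ∀ {x′} → R x′ z → Near x′
      near-z {x′} Rx′z with R? x′ y₂
      ... | yes Rx′y₂ = inj₂ (y₂ , Rxy₂ , Rx′y₂)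
      -- The columns of `y₂` and `z` share `x₁`, and `x₂` is the one element that `z` has beyond
      -- `y₂`; hence `x′` is `x₂`, which is adjacent to `y₁`.
      ... | no ¬Rx′y₂ with refl ← extra-uniqueᶜ Rx₁y₂ Rx₁z Rx₂z₂ ¬Rx₂y₂ Rx′z ¬Rx′y₂
        = inj₂ (y₁ , Rxy₁ , Rx₂y₁)

      fw : ∀ {x′ y} → R x′ y → Near x′ → R x y ⊎ y ≡ z
      fw Rxy (inj₁ refl) = inj₁ Rxy
      fw {y = y} Rx′y (inj₂ (y′ , Rxy′ , Rx′y′)) with R? x y
      ... | yes Rxy = inj₁ Rxy
      ... | no ¬Rxy = inj₂ (extra-agree three Rxy′ Rx′y′ Rxy₂ Rx₁y₂ Rx′y ¬Rxy Rx₁z ¬Rxz)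

      bw : ∀ {x′ y} → R x′ y → R x y ⊎ y ≡ z → Near x′
      bw Rx′y (inj₁ Rxy)  = inj₂ (_ , Rxy , Rx′y)
      bw Rx′z (inj₂ refl) = near-z Rx′z

module _ {R : REL (Fin m) (Fin n) a} (P : ConnectedPrivate R) where
  open ConnectedPrivate P

  threeNeighbours-everywhere : ∀ {x₀} → ThreeNeighbours R x₀ →
    (∀ x → ThreeNeighbours R x) × (∀ y → ThreeNeighbours (flip R) y)
  threeNeighbours-everywhere =
    spread (Wide.threeNeighbours-adjacent P) (Wide.threeNeighbours-adjacent (flipped P))

  -- Non-adjacency is a perfect matching `μ` of attributes with individuals; renaming each attribute
  -- by its partner turns `R` into inequality.
  wide⇒spherical : ∀ {x₀} → ThreeNeighbours R x₀ → IsSphericalBoundary R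
  wide⇒spherical {x₀} three₀ = m , Exchange.m≥3 P x₀ , ⤖-id (Fin m) , μ-bijection , R⇔
    where
    rows : ∀ x → ∃[ z ] ¬ R x z × (∀ y → R x y ⊎ y ≡ z)
    rows = Wide.unique-nonneighbour P ∘ proj₁ (threeNeighbours-everywhere three₀)
    columns : ∀ y → ∃[ z ] ¬ R z y × (∀ x → R x y ⊎ x ≡ z)
    columns = Wide.unique-nonneighbour (flipped P) ∘ proj₂ (threeNeighbours-everywhere three₀)

    μ : Fin n → Fin m
    μ = proj₁ ∘ columns

    nonneighbour-row : ∀ {x y} → ¬ R x y → y ≡ proj₁ (rows x)
    nonneighbour-row {x} {y} ¬Rxy = [ (λ r → contradiction r ¬Rxy) , id ]′ (proj₂ (proj₂ (rows x)) y)
    nonneighbour-column : ∀ {x y} → ¬ R x y → x ≡ μ y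
    nonneighbour-column {x} {y} ¬Rxy = [ (λ r → contradiction r ¬Rxy) , id ]′ (proj₂ (proj₂ (columns y)) x)

    μ-bijection : Fin n ⤖ Fin m
    μ-bijection = mk⤖
      ( (λ {y} {y′} eq → trans (nonneighbour-row (proj₁ (proj₂ (columns y))))
          (sym (nonneighbour-row (subst (λ x → ¬ R x y′) (sym eq) (proj₁ (proj₂ (columns y′)))))))
      , λ x → proj₁ (rows x) , λ { refl → sym (nonneighbour-column (proj₁ (proj₂ (rows x)))) } )

    R⇔ : ∀ x y → R x y ⇔ x ≢ μ y
    R⇔ x y = mk⇔ (λ { Rxy refl → proj₁ (proj₂ (columns y)) Rxy })
                 (λ x≢μy → decidable-stable (R? x y) (x≢μy ∘ nonneighbour-column))

-- Isomorphisms, minimal indices and enumerations.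

≅-sym : ∀ {m′ n′} {R : REL (Fin m) (Fin n) a} {S : REL (Fin m′) (Fin n′) p} → R ≅ S → S ≅ R
≅-sym {R = R} {S} (f , g , R⇔S) = ⤖-sym f , ⤖-sym g , S⇔R
  where
  S⇔R : ∀ x y → S x y ⇔ R (Bijection.to (⤖-sym f) x) (Bijection.to (⤖-sym g) y)
  S⇔R x y with i , fi≡x ← Bijection.surjective f x | j , gj≡y ← Bijection.surjective g y
    with refl ← fi≡x refl | refl ← gj≡y refl = ⇔-sym (R⇔S i j)

≅-square⇒≡ : ∀ {R : REL (Fin m) (Fin n) a} {S : REL (Fin k) (Fin k) p} → R ≅ S → m ≡ n
≅-square⇒≡ (f , g , _) = trans (↔⇒≡ (⤖⇒↔ f)) (sym (↔⇒≡ (⤖⇒↔ g)))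

least : ∀ {P : Pred ℕ p} → U.Decidable P → ∀ k → P k →
        ∃[ l ] P l × (∀ {j} → j < l → ¬ P j)
least {P = P} P? = <-rec _ λ k rec Pk → case k rec Pk
  where
  case : ∀ k → (∀ {j} → j < k → P j → ∃[ l ] P l × (∀ {j} → j < l → ¬ P j)) →
         P k → ∃[ l ] P l × (∀ {j} → j < l → ¬ P j)
  case k rec Pk with ℕ.anyUpTo? P? k
  ... | yes (j , j<k , Pj) = rec j<k Pj
  ... | no ∄j              = k , Pk , λ j<k Pj → ∄j (_ , j<k , Pj)

enumeration : (f : ℕ → Fin m) → (∀ {i j} → i < k → j < k → f i ≡ f j → i ≡ j) →
              (∀ x → ∃[ i ] i < k × f i ≡ x) → Fin k ⤖ Fin m
enumeration f inj covers = mk⤖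
  ( (λ {i} {j} eq → toℕ-injective (inj (toℕ<n i) (toℕ<n j) eq))
  , λ x → let i , i<k , fi≡x = covers x in
          fromℕ< i<k , λ { refl → trans (cong f (toℕ-fromℕ< i<k)) fi≡x } )

<-distinct⇒injective : (f : ℕ → Fin m) → (∀ {i j} → i < j → j < k → f i ≢ f j) →
                       ∀ {i j} → i < k → j < k → f i ≡ f j → i ≡ j
<-distinct⇒injective f distinct {i} {j} i<k j<k eq with ℕ.<-cmp i j
... | tri< i<j _ _ = contradiction eq (distinct i<j j<k)
... | tri≈ _ i≡j _ = i≡j
... | tri> _ _ j<i = contradiction (sym eq) (distinct j<i i<k)

-- Two neighbours everywhere: the cyclic staircase.

module Cycle {R : REL (Fin m) (Fin n) a} (P : ConnectedPrivate R)
             (narrow : ∀ x → ¬ ThreeNeighbours R x)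
             (narrowᶜ : ∀ y → ¬ ThreeNeighbours (flip R) y)
             (x₀ : Fin m) where
  open ConnectedPrivate P
  open Exchange P using (m≥3; another)
  open Exchange (flipped P) using () renaming (another to anotherᶜ)

  private
    two : ∀ {m n} {R : REL (Fin m) (Fin n) a} {x y y′ w} → ¬ ThreeNeighbours R x →
          R x y → R x y′ → y′ ≢ y → R x w → w ≡ y ⊎ w ≡ y′
    two {y = y} {y′} {w} ¬three Rxy Rxy′ y′≢y Rxw with w ≟ y | w ≟ y′
    ... | yes w≡y | _        = inj₁ w≡y
    ... | no  _   | yes w≡y′ = inj₂ w≡y′
    ... | no w≢y  | no w≢y′  = contradiction
      (w , y , y′ , (Rxw , Rxy , Rxy′) , (w≢y , w≢y′ , ≢-sym y′≢y)) ¬three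

  -- The state of a walk that has just passed from `y` to `x`; keeping the edge fixes the direction
  -- of travel. The walk runs `Y 0`, `X 0`, `Y 1`, `X 1`, and so on.
  Flag : Set a
  Flag = ∃[ x ] ∃[ y ] R x y

  next : Flag → Flag
  next (x , y , Rxy) with y′ , Rxy′ , _ ← another Rxy with x′ , Rx′y′ , _ ← anotherᶜ Rxy′ = x′ , y′ , Rx′y′

  abstract
    flag : ℕ → Flag
    flag zero    = x₀ , neighbour x₀
    flag (suc i) = next (flag i)

    X : ℕ → Fin m
    X i = proj₁ (flag i)

    Y : ℕ → Fin n
    Y i = proj₁ (proj₂ (flag i))

    level : ∀ i → R (X i) (Y i)
    level i = proj₂ (proj₂ (flag i))

    up : ∀ i → R (X i) (Y (suc i))
    up i = proj₁ (proj₂ (another (level i)))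

    Y-step : ∀ i → Y (suc i) ≢ Y i
    Y-step i = proj₂ (proj₂ (another (level i)))

    X-step : ∀ i → X (suc i) ≢ X i
    X-step i = proj₂ (proj₂ (anotherᶜ (up i)))

  X-neighbours : ∀ i {y} → R (X i) y → y ≡ Y i ⊎ y ≡ Y (suc i)
  X-neighbours i = two {R = R} (narrow _) (level i) (up i) (Y-step i)

  Y-neighbours : ∀ i {x} → R x (Y (suc i)) → x ≡ X i ⊎ x ≡ X (suc i)
  Y-neighbours i = two {R = flip R} (narrowᶜ _) (up i) (level (suc i)) (X-step i)

  -- Meeting the walk in the opposite direction would fold it at a vertex or an edge midway.
  no-reversal : ∀ d i → X i ≡ X (d + i) → Y (suc i) ≢ Y (d + i)
  no-reversal 0 i _ = Y-step i
  no-reversal 1 i X≡ _ = X-step i (sym X≡)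
  -- Both ends move inward by one step, so the gap shrinks by two.
  no-reversal (suc (suc d)) i X≡ Y≡ = no-reversal d (suc i) X≡′ Y≡′
    where
    X≡₁ : X (suc i) ≡ X (suc (d + i))
    X≡₁ with Y-neighbours (suc (d + i)) (subst (R (X (suc i))) Y≡ (level (suc i)))
    ... | inj₁ eq = eq
    ... | inj₂ eq = contradiction (trans eq (sym X≡)) (X-step i)
    Y≡₁ : Y (suc (suc i)) ≡ Y (suc (d + i))
    Y≡₁ with X-neighbours (suc (d + i)) (subst (λ x → R x (Y (suc (suc i)))) X≡₁ (up (suc i)))
    ... | inj₁ eq = eq
    ... | inj₂ eq = contradiction (trans eq (sym Y≡)) (Y-step (suc i))
    X≡′ : X (suc i) ≡ X (d + suc i)
    X≡′ = trans X≡₁ (cong X (sym (ℕ.+-suc d i)))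
    Y≡′ : Y (suc (suc i)) ≡ Y (d + suc i)
    Y≡′ = trans Y≡₁ (cong Y (sym (ℕ.+-suc d i)))

  X≡⇒Y≡ : ∀ d i → X i ≡ X (d + i) → Y i ≡ Y (d + i)
  X≡⇒Y≡ d i X≡ with X-neighbours i (subst (λ x → R x (Y (d + i))) (sym X≡) (level (d + i)))
  ... | inj₁ eq = sym eq
  ... | inj₂ eq = contradiction (sym eq) (no-reversal d i X≡)

  -- A repetition is traced back to time 0: once the edges at `suc i` agree, the preceding
  -- individual is determined as the other neighbour of the shared attribute.
  X-return : ∀ d i → X i ≡ X (d + i) → X 0 ≡ X d
  X-return d zero    X≡ = trans X≡ (cong X (ℕ.+-identityʳ d))
  X-return d (suc i) X≡ = X-return d i back
    where
    X≡′ : X (suc i) ≡ X (suc (d + i))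
    X≡′ = trans X≡ (cong X (ℕ.+-suc d i))
    Y≡′ : Y (suc i) ≡ Y (suc (d + i))
    Y≡′ = trans (X≡⇒Y≡ d (suc i) X≡) (cong Y (ℕ.+-suc d i))
    back : X i ≡ X (d + i)
    back with Y-neighbours (d + i) (subst (R (X i)) Y≡′ (up i))
    ... | inj₁ eq = eq
    ... | inj₂ eq = contradiction (sym (trans eq (sym X≡′))) (X-step i)

  -- The bound by `j` lets minimality of the first return rule out repetitions within a period.
  X-return-< : ∀ {i j} → i < j → X i ≡ X j → ∃[ d ] suc d ≤ j × X 0 ≡ X (suc d)
  X-return-< {i} i<j X≡ with d , refl ← ℕ.m≤n⇒∃[o]m+o≡n i<j =
    d , s≤s (ℕ.m≤n+m d i)
    , X-return (suc d) i (trans X≡ (cong (X ∘ suc) (ℕ.+-comm i d)))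

  abstract
    -- Among `m + 1` individuals of the walk two agree. The index is one less than the return time,
    -- which excludes the trivial return at time 0.
    first-return : ∃[ l ] X 0 ≡ X (suc l) × (∀ {j} → j < l → X 0 ≢ X (suc j))
    first-return with i , j , i<j , X≡ ← pigeonhole (ℕ.n<1+n m) (X ∘ toℕ)
      with d , _ , X0≡ ← X-return-< i<j X≡
      = least (λ l → X 0 ≟ X (suc l)) d X0≡

  l : ℕ
  l = proj₁ first-return

  period : ℕ
  period = suc l

  X-closes : X 0 ≡ X period
  X-closes = proj₁ (proj₂ first-return)

  Y-closes : Y 0 ≡ Y period
  Y-closes = trans (X≡⇒Y≡ period 0 (trans X-closes (cong X (sym (ℕ.+-identityʳ period)))))
                   (cong Y (ℕ.+-identityʳ period))

  X-distinct : ∀ {i j} → i < j → j < period → X i ≢ X j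
  X-distinct i<j j<period X≡ with d , d<j , X0≡ ← X-return-< i<j X≡ =
    proj₂ (proj₂ first-return) (ℕ.<-≤-trans d<j (s≤s⁻¹ j<period)) X0≡

  -- Equal attributes would make `X i` a neighbour of `Y (suc j)`, hence `X j` or `X (suc j)`. Only
  -- `i = j` survives, and then consecutive attributes would agree.
  Y-distinct : ∀ {i j} → i < j → j < period → Y i ≢ Y j
  Y-distinct {i} {suc j} i<1+j 1+j<period Y≡
    with Y-neighbours j (subst (R (X i)) Y≡ (level i))
  ... | inj₂ X≡ = X-distinct i<1+j 1+j<period X≡
  ... | inj₁ X≡ with ℕ.m≤n⇒m<n∨m≡n (s≤s⁻¹ i<1+j)
  ...   | inj₁ i<j  = X-distinct i<j (ℕ.<-trans (ℕ.n<1+n j) 1+j<period) X≡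
  ...   | inj₂ refl = Y-step j (sym Y≡)

  X-injective : ∀ {i j} → i < period → j < period → X i ≡ X j → i ≡ j
  X-injective = <-distinct⇒injective X X-distinct

  Y-injective : ∀ {i j} → i < period → j < period → Y i ≡ Y j → i ≡ j
  Y-injective = <-distinct⇒injective Y Y-distinct

  -- The visited vertices are closed under adjacency, since both neighbours of each lie on the walk.
  covers : (∀ x → ∃[ i ] i < period × X i ≡ x) × (∀ y → ∃[ i ] i < period × Y i ≡ y)
  covers = spread fw bw (0 , z<s , refl)
    where
    fw : ∀ {x y} → R x y → ∃[ i ] i < period × X i ≡ x → ∃[ i ] i < period × Y i ≡ y
    fw Rxy (i , i<period , refl) with X-neighbours i Rxy
    ... | inj₁ eq = i , i<period , sym eq
    ... | inj₂ eq with ℕ.m≤n⇒m<n∨m≡n i<period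
    ...   | inj₁ 1+i<period = suc i , 1+i<period , sym eq
    ...   | inj₂ refl       = 0 , z<s , trans Y-closes (sym eq)
    bw : ∀ {x y} → R x y → ∃[ i ] i < period × Y i ≡ y → ∃[ i ] i < period × X i ≡ x
    -- `Y 0` is `Y period`, so its neighbours are `X l` and `X period`, the latter being `X 0`.
    bw Rxy (zero , _ , refl) with Y-neighbours l (subst (R _) Y-closes Rxy)
    ... | inj₁ eq = l , ℕ.n<1+n l , sym eq
    ... | inj₂ eq = 0 , z<s , trans X-closes (sym eq)
    bw Rxy (suc i , 1+i<period , refl) with Y-neighbours i Rxy
    ... | inj₁ eq = i , ℕ.<-trans (ℕ.n<1+n i) 1+i<period , sym eq
    ... | inj₂ eq = suc i , 1+i<period , sym eq

  R⇔staircase : ∀ (i j : Fin period) → R (X (toℕ i)) (Y (toℕ j)) ⇔ CyclicStaircase period i j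
  R⇔staircase i j = mk⇔ to from
    where
    to : R (X (toℕ i)) (Y (toℕ j)) → CyclicStaircase period i j
    to r with X-neighbours (toℕ i) r
    ... | inj₁ eq with refl ← toℕ-injective (Y-injective (toℕ<n j) (toℕ<n i) eq) = diagonal
    ... | inj₂ eq with ℕ.m≤n⇒m<n∨m≡n (toℕ<n i)
    ...   | inj₁ 1+i<period = step (Y-injective (toℕ<n j) 1+i<period eq)
    -- At the last index the next attribute is `Y period`, which is `Y 0`.
    ...   | inj₂ 1+i≡period = wrap 1+i≡period (Y-injective (toℕ<n j) z<s
              (trans eq (trans (cong Y 1+i≡period) (sym Y-closes))))
    from : CyclicStaircase period i j → R (X (toℕ i)) (Y (toℕ j))
    from diagonal   = level (toℕ i)
    from (step j≡)  = subst (R _) (cong Y (sym j≡)) (up (toℕ i))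
    from (wrap i≡ j≡) =
      subst (R _) (trans (cong Y i≡) (trans (sym Y-closes) (cong Y (sym j≡)))) (up (toℕ i))

  staircase : IsCyclicStaircase R
  -- The enumeration of individuals identifies `period` with `m`.
  staircase = period , subst (3 ≤_) (sym (↔⇒≡ (⤖⇒↔ X-bijection))) (m≥3 x₀)
            , ≅-sym (X-bijection , Y-bijection , λ i j → ⇔-sym (R⇔staircase i j))
    where
    X-bijection : Fin period ⤖ Fin m
    X-bijection = enumeration X X-injective (proj₁ covers)
    Y-bijection : Fin period ⤖ Fin n
    Y-bijection = enumeration Y Y-injective (proj₂ covers)

-- The dichotomy.

inhabitant : m ≢ 0 → Fin m
inhabitant {zero}  0≢0 = contradiction refl 0≢0
inhabitant {suc _} _   = zero

theorem74 : ∀ {a} (m n : ℕ) (R : REL (Fin m) (Fin n) a) (R? : Decidable R) →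
    ¬ Void R →
    Connected R →
    Tight R? →
    PreservesAttributePrivacy R? →
    PreservesAssociationPrivacy R? →
    (m ≡ n × m ≥ 3) × (IsCyclicStaircase R ⊎ IsSphericalBoundary R)
theorem74 m n R R? nonvoid connected (tightˣ , tightʸ) attribute association =
  ([ size CyclicStaircase , size SphericalBoundary ]′ shape , Exchange.m≥3 P x₀) , shape
  where
  P : ConnectedPrivate R
  P = record
    { R?           = R?
    ; connected    = connected
    ; neighbour    = nonempty-rows R? tightˣ
    ; neighbourᶜ   = nonempty-rows (flip R?) tightʸ
    ; replacement  = attributePrivacy⇒replaces R? attribute
    ; replacementᶜ = attributePrivacy⇒replaces (flip R?) association
    }

  x₀ : Fin m
  x₀ = inhabitant (nonvoid ∘ inj₁)

  size : (S : (k : ℕ) → REL (Fin k) (Fin k) 0ℓ) → ∃[ k ] (3 ≤ k × R ≅ S k) → m ≡ n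
  size S (k , _ , R≅S) = ≅-square⇒≡ {R = R} {S = S k} R≅S

  shape : IsCyclicStaircase R ⊎ IsSphericalBoundary R
  shape with Wide.threeNeighbours? P x₀
  ... | yes three₀ = inj₂ (wide⇒spherical P three₀)
  -- Three neighbours at any vertex would spread to `x₀`.
  ... | no ¬three₀ = inj₁ (Cycle.staircase P
    (λ x three → ¬three₀ (proj₁ (threeNeighbours-everywhere P three) x₀))
    (λ y three → ¬three₀ (proj₂ (threeNeighbours-everywhere (flipped P) three) x₀))
    x₀)
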